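{- There exist absolute constants $C>0$ and $k_0$ such that for every integer $k\ge k_0$, every tournament on at least $C k^2\log\log k$ vertices contains a copy of $H_k$ as a subgraph. Equivalently, $\vec{r}(H_k)=O(k^2\log\log k)$.
   Context: A tournament is a digraph in which for every two distinct vertices $u,v$ exactly one of the arcs $\vec{uv}$, $\vec{vu}$ is present. $T_k$ denotes the transitive tournament on $k$ vertices (vertices ordered $v_1,\dots,v_k$ with arcs exactly $\vec{v_iv_j}$ for $i<j$). $H_k$ denotes the $1$-subdivision of $T_k$, i.e. the digraph obtained from $T_k$ by replacing every arc $\vec{uv}$ by a directed path $u\to w_{uv}\to v$ of length $2$ through a new vertex $w_{uv}$ (distinct new vertices for distinct arcs). For an acyclic digraph $H$, the oriented Ramsey number $\vec{r}(H)$ is the smallest $n$ such that every $n$-vertex tournament contains a copy of $H$ as a subgraph. Logarithms are base $2$. -}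

module Defs where

open import Data.Nat using (ℕ; _≤_; _*_; _^_)
open import Data.Nat.Logarithm using (⌈log₂_⌉)
open import Data.Fin using (Fin; _<_)
open import Data.Sum using (_⊎_; inj₁; inj₂)
open import Data.Product using (Σ; Σ-syntax; _×_; _,_; proj₁; proj₂)
open import Data.Empty using (⊥)
open import Relation.Binary.PropositionalEquality using (_≡_)
open import Relation.Nullary using (¬_)
open import Function.Definitions using (Injective)

record Tournament (n : ℕ) : Set₁ where
  field
    Arc      : Fin n → Fin n → Set
    loopless : ∀ u → ¬ Arc u u
    total    : ∀ u v → ¬ u ≡ v → Arc u v ⊎ Arc v u
    asym     : ∀ u v → Arc u v → ¬ Arc v u

record Digraph : Set₁ where
  field
    V   : Set
    Arc : V → V → Set

-- Vertices of H_k: the k vertices v_i of T_k (inj₁ i), and one subdivision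
-- vertex w_{v_i v_j} for every arc v_i → v_j of T_k, i.e. every i < j (inj₂).
HVertex : ℕ → Set
HVertex k = Fin k ⊎ (Σ[ p ∈ Fin k × Fin k ] (proj₁ p < proj₂ p))

HArc : (k : ℕ) → HVertex k → HVertex k → Set
HArc k (inj₁ u) (inj₂ ((i , j) , _)) = u ≡ i
HArc k (inj₂ ((i , j) , _)) (inj₁ v) = v ≡ j
HArc k (inj₁ _) (inj₁ _) = ⊥
HArc k (inj₂ _) (inj₂ _) = ⊥

-- H_k: the 1-subdivision of the transitive tournament T_k.
H : ℕ → Digraph
H k = record { V = HVertex k ; Arc = HArc k }

ContainsCopy : ∀ {n} → Tournament n → Digraph → Set
ContainsCopy {n} T D =
  Σ[ φ ∈ (Digraph.V D → Fin n) ]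
    (Injective _≡_ _≡_ φ ×
     (∀ x y → Digraph.Arc D x y → Tournament.Arc T (φ x) (φ y)))

loglog : ℕ → ℕ
loglog k = ⌈log₂ ⌈log₂ k ⌉ ⌉

{-# OPTIONS --safe #-}
module Submission where

-- Let a(u,v) be the number of paths u → w → v and δ(u,v) = a(u,v) + a(v,u). Up to the vertices
-- u, v themselves, δ is the size of the symmetric difference of the out-neighbourhoods, so
-- δ(u,v) ≤ 2 a(u,v) + 1 when u has the larger out-degree, and, as every set of m vertices spans
-- about m³/6 paths of length 2, each ball of radius d in δ has only O(d) vertices.
-- Hence, if n ≥ C k², a greedy choice of k vertices keeps all distances above 16k, while the number
-- of chosen pairs at distance at most 16k·2^j stays O(k·2^j) for all j at once: a random vertex adds
-- at most 2^j such pairs on average, and a quadratic potential controls the fluctuations.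
-- Ordering the chosen vertices by out-degree, the subdivision vertices can be picked greedily,
-- treating the pairs in increasing order of δ.

open import Defs
open import Data.Nat using (ℕ; zero; suc; _+_; _∸_; _≤_; _<_; _*_; _^_; z≤n; s≤s; NonZero; >-nonZero)
open import Data.Nat.Properties
open import Data.Nat.ListAction using (sum)
open import Data.Nat.ListAction.Properties using (sum-↭; sum-++)
open import Data.Nat.Logarithm using (⌈log₂⌉-mono-≤)
open import Data.Nat.Tactic.RingSolver using (solve-∀)
open import Data.Fin using (Fin)
import Data.Fin as Fin using (zero; suc; _<_)
import Data.Fin.Properties as Fin
open import Data.List using (List; []; _∷_; _++_; length; map; filter; allFin; lookup)
open import Data.List.Properties using (length-map; length-++; length-tabulate; map-cong; map-++; map-∘)
open import Data.List.Membership.Propositional using (_∈_; _∉_; find; lose)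
open import Data.List.Membership.Propositional.Properties using (∈-filter⁻; ∈-map⁺; ∈-++⁺ˡ; ∈-++⁺ʳ; ∈-lookup)
open import Data.List.Relation.Unary.All using (All; []; _∷_)
import Data.List.Relation.Unary.All as All
import Data.List.Relation.Unary.All.Properties as All using (++⁺; map⁺)
open import Data.List.Relation.Unary.Any using (here; there; any?)
open import Data.List.Relation.Unary.AllPairs using (AllPairs; []; _∷_)
open import Data.List.Relation.Unary.Unique.Propositional using (Unique)
import Data.List.Relation.Unary.Unique.Propositional.Properties as Unique
open import Data.List.Relation.Binary.Permutation.Propositional using (_↭_; refl; prep; swap; trans; ↭-sym)
import Data.List.Relation.Binary.Permutation.Propositional.Properties as ↭
open import Data.Product using (Σ-syntax; ∃; ∃-syntax; _×_; _,_; proj₁; proj₂)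
open import Data.Product.Properties using (≡-dec)
open import Data.Sum using (_⊎_; inj₁; inj₂; [_,_]′)
open import Function using (_∘_; id)
open import Relation.Nullary using (Dec; yes; no; ¬?; contradiction)
open import Relation.Nullary.Decidable using (decidable-stable; _×-dec_)
open import Relation.Binary.Definitions using (DecidableEquality; tri<; tri≈; tri>)
open import Relation.Unary using (Decidable)
open import Relation.Binary.PropositionalEquality using (_≡_; _≢_; sym; cong; cong₂; subst)
import Relation.Binary.PropositionalEquality as ≡

private
  variable
    A B : Set

-- Sums and indicators over lists.

∑ : List A → (A → ℕ) → ℕ
∑ xs f = sum (map f xs)

infix 8 ∑
syntax ∑ xs (λ x → e) = ∑[ x ∈ xs ] e

𝟙 : {P : Set} → Dec P → ℕ
𝟙 (yes _) = 1
𝟙 (no _)  = 0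

𝟙-yes : {P : Set} (d : Dec P) → P → 𝟙 d ≡ 1
𝟙-yes (yes _) p = ≡.refl
𝟙-yes (no ¬p) p = contradiction p ¬p

𝟙≤1 : {P : Set} (d : Dec P) → 𝟙 d ≤ 1
𝟙≤1 (yes _) = ≤-refl
𝟙≤1 (no _)  = z≤n

𝟙-mono : {P Q : Set} (d : Dec P) (e : Dec Q) → (P → Q) → 𝟙 d ≤ 𝟙 e
𝟙-mono (yes p) e f = ≤-reflexive (sym (𝟙-yes e (f p)))
𝟙-mono (no _)  e f = z≤n

∑-mono-∈ : ∀ (xs : List A) {f g : A → ℕ} → (∀ {x} → x ∈ xs → f x ≤ g x) → ∑ xs f ≤ ∑ xs g
∑-mono-∈ []       h = z≤n
∑-mono-∈ (x ∷ xs) h = +-mono-≤ (h (here ≡.refl)) (∑-mono-∈ xs (h ∘ there))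

∑-mono : ∀ (xs : List A) {f g : A → ℕ} → (∀ x → f x ≤ g x) → ∑ xs f ≤ ∑ xs g
∑-mono xs h = ∑-mono-∈ xs (λ {x} _ → h x)

∑-cong : ∀ (xs : List A) {f g : A → ℕ} → (∀ x → f x ≡ g x) → ∑ xs f ≡ ∑ xs g
∑-cong xs h = cong sum (map-cong h xs)

interchange : ∀ a b c d → a + b + (c + d) ≡ a + c + (b + d)
interchange = solve-∀

∑-+ : ∀ (xs : List A) (f g : A → ℕ) → ∑[ x ∈ xs ] (f x + g x) ≡ ∑ xs f + ∑ xs g
∑-+ []       f g = ≡.refl
∑-+ (x ∷ xs) f g rewrite ∑-+ xs f g = interchange (f x) (g x) (∑ xs f) (∑ xs g)

∑-* : ∀ (xs : List A) c (f : A → ℕ) → ∑[ x ∈ xs ] (c * f x) ≡ c * ∑ xs f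
∑-* []       c f = sym (*-zeroʳ c)
∑-* (x ∷ xs) c f rewrite ∑-* xs c f = sym (*-distribˡ-+ c (f x) (∑ xs f))

∑-const : ∀ (xs : List A) c → ∑[ x ∈ xs ] c ≡ length xs * c
∑-const []       c = ≡.refl
∑-const (x ∷ xs) c = cong (c +_) (∑-const xs c)

∑-comm : ∀ (xs : List A) (ys : List B) (f : A → B → ℕ) →
         ∑[ x ∈ xs ] (∑[ y ∈ ys ] f x y) ≡ ∑[ y ∈ ys ] (∑[ x ∈ xs ] f x y)
∑-comm []       ys f = sym (≡.trans (∑-const ys 0) (*-zeroʳ (length ys)))
∑-comm (x ∷ xs) ys f rewrite ∑-comm xs ys f = sym (∑-+ ys (f x) (λ y → ∑[ x′ ∈ xs ] f x′ y))

∑-↭ : {xs ys : List A} (f : A → ℕ) → xs ↭ ys → ∑ xs f ≡ ∑ ys f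
∑-↭ f p = sum-↭ (↭.map⁺ f p)

∑-filter-≤ : {P : A → Set} (P? : Decidable P) (xs : List A) (f : A → ℕ) → ∑ (filter P? xs) f ≤ ∑ xs f
∑-filter-≤ P? []       f = z≤n
∑-filter-≤ P? (x ∷ xs) f with P? x
... | yes _ = +-monoʳ-≤ (f x) (∑-filter-≤ P? xs f)
... | no _  = m≤n⇒m≤o+n (f x) (∑-filter-≤ P? xs f)

length-filter≡∑ : {P : A → Set} (P? : Decidable P) (xs : List A) → length (filter P? xs) ≡ ∑[ x ∈ xs ] 𝟙 (P? x)
length-filter≡∑ P? []       = ≡.refl
length-filter≡∑ P? (x ∷ xs) with P? x
... | yes _ = cong suc (length-filter≡∑ P? xs)
... | no _  = length-filter≡∑ P? xs

-- The first-moment method: were every `f x` at least `suc b`, the sum would exceed `length xs * b`.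
-- This takes the place of drawing a random vertex.
∑≤average : ∀ (xs : List A) (f : A → ℕ) b → 0 < length xs → ∑ xs f ≤ length xs * b →
            ∃[ x ] (x ∈ xs × f x ≤ b)
∑≤average xs f b xs≢[] ∑≤ with any? (λ x → f x ≤? b) xs
... | yes p = find p
... | no ¬p = contradiction ∑≤ (<⇒≱ (begin-strict
    length xs * b       <⟨ *-monoʳ-< (length xs) {{>-nonZero xs≢[]}} (n<1+n b) ⟩
    length xs * suc b   ≡⟨ ∑-const xs (suc b) ⟨
    ∑[ x ∈ xs ] suc b   ≤⟨ ∑-mono-∈ xs (λ x∈xs → ≰⇒> (λ fx≤b → ¬p (lose x∈xs fx≤b))) ⟩
    ∑ xs f              ∎))
  where open ≤-Reasoning

-- Sorting by a key, and distinct representatives.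

module Ranking (key : A → ℕ) where

  open import Relation.Binary.Bundles using (DecTotalOrder)
  import Relation.Binary.Construct.On as On
  import Relation.Binary.Construct.Flip.EqAndOrd as Flip
  open import Data.List.Relation.Unary.Sorted.TotalOrder.Properties using (Sorted⇒AllPairs)

  descending : DecTotalOrder _ _ _
  descending = On.decTotalOrder (Flip.decTotalOrder ≤-decTotalOrder) key

  open import Data.List.Sort descending public using (sort; sort-↭; sort-↗)

  sort-descending : ∀ xs → AllPairs (λ x y → key y ≤ key x) (sort xs)
  sort-descending xs = Sorted⇒AllPairs (DecTotalOrder.totalOrder descending) (sort-↗ xs)

length-remove : (xs : List A) {x : A} (x∈xs : x ∈ xs) →
                ∃[ ys ] (length xs ≡ suc (length ys) × (∀ {z} → z ∈ xs → z ≢ x → z ∈ ys))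
length-remove (x ∷ xs) (here ≡.refl) = xs , ≡.refl , λ
  { (here z≡x) z≢x → contradiction z≡x z≢x
  ; (there z∈xs) _ → z∈xs }
length-remove (y ∷ xs) (there x∈xs) with length-remove xs x∈xs
... | ys , eq , rest = y ∷ ys , cong suc eq , λ
  { (here z≡y) _ → here z≡y
  ; (there z∈xs) z≢x → there (rest z∈xs z≢x) }

unique-⊆⇒length≤ : {xs : List A} → Unique xs → (ys : List A) → (∀ {z} → z ∈ xs → z ∈ ys) → length xs ≤ length ys
unique-⊆⇒length≤ []             ys sub = z≤n
unique-⊆⇒length≤ (x∉xs ∷ uniq) ys sub with length-remove ys (sub (here ≡.refl))
... | zs , eq , rest = subst (_ ≤_) (sym eq) (s≤s (unique-⊆⇒length≤ uniq zs
        (λ z∈xs → rest (sub (there z∈xs)) (λ z≡x → All.lookup x∉xs z∈xs (sym z≡x)))))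

module _ (_≟_ : DecidableEquality A) where

  open import Data.List.Membership.DecPropositional _≟_ using (_∈?_)

  fresh : {xs : List A} → Unique xs → (ys : List A) → length ys < length xs → ∃[ x ] (x ∈ xs × x ∉ ys)
  fresh {xs} uniq ys ys<xs with any? (λ x → ¬? (x ∈? ys)) xs
  ... | yes p = find p
  ... | no ¬p = contradiction (unique-⊆⇒length≤ uniq ys
          (λ {z} z∈xs → decidable-stable (z ∈? ys) (λ z∉ys → ¬p (lose z∈xs z∉ys)))) (<⇒≱ ys<xs)

module _ (_≟ᴬ_ : DecidableEquality A) (_≟ᴮ_ : DecidableEquality B)
         (key : A → ℕ) (choices : A → List B) (choices! : ∀ p → Unique (choices p))
         (forbidden : List B) (default : A → B) where

  -- For `p` in `xs` the count includes `p` itself and all ties, so it bounds the number of items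
  -- served up to and including `p`.
  rank : List A → A → ℕ
  rank xs p = ∑[ q ∈ xs ] 𝟙 (key q ≤? key p)

  Representatives : List A → Set
  Representatives xs = Σ[ w ∈ (A → B) ]
    ((∀ {p} → p ∈ xs → w p ∈ choices p × w p ∉ forbidden) ×
     (∀ {p q} → p ∈ xs → q ∈ xs → w p ≡ w q → p ≡ q))

  rank-top : ∀ {x} xs → All (λ y → key y ≤ key x) xs → rank xs x ≡ length xs
  rank-top []       []         = ≡.refl
  rank-top (y ∷ xs) (h ∷ hs) = cong₂ _+_ (𝟙-yes (key y ≤? _) h) (rank-top xs hs)

  -- The head has the largest key and is served last. By then each item of the tail blocks at most
  -- one value, while the rank of the head counts the whole list, the head included; so one
  -- admissible value is left. Dropping the head only lowers the ranks in the tail, which gives the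
  -- induction.
  representatives-descending : ∀ xs → AllPairs (λ x y → key y ≤ key x) xs →
    (∀ {p} → p ∈ xs → length forbidden + rank xs p ≤ length (choices p)) → Representatives xs
  representatives-descending []       _              _    = default , (λ ()) , (λ ())
  -- `default` merely makes `w` total: every listed item gets its value by an override further up
  -- the recursion.
  representatives-descending (x ∷ xs) (x-top ∷ desc) room
    with representatives-descending xs desc
           (λ {p} p∈xs → ≤-trans (+-monoʳ-≤ (length forbidden) (m≤n+m _ (𝟙 (key x ≤? key p)))) (room (there p∈xs)))
  ... | w , w-choice , w-inj
    with fresh _≟ᴮ_ (choices! x) (forbidden ++ map w xs) few
    where
    open ≤-Reasoning
    few : length (forbidden ++ map w xs) < length (choices x)
    few = begin-strict
      length (forbidden ++ map w xs)         ≡⟨ length-++ forbidden ⟩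
      length forbidden + length (map w xs)   ≡⟨ cong (length forbidden +_) (length-map w xs) ⟩
      length forbidden + length xs           <⟨ +-monoʳ-< (length forbidden) (n<1+n (length xs)) ⟩
      length forbidden + length (x ∷ xs)     ≡⟨ cong (length forbidden +_) (rank-top (x ∷ xs) (≤-refl ∷ x-top)) ⟨
      length forbidden + rank (x ∷ xs) x     ≤⟨ room (here ≡.refl) ⟩
      length (choices x)                     ∎
  ... | b , b∈choices , b-fresh = w′ , w′-choice , w′-inj
    where
    -- The list may repeat `x`. The override acts on all copies at once, so `w` is consulted only at
    -- items different from `x`.
    w′ : A → B
    w′ p with p ≟ᴬ x
    ... | yes _ = b
    ... | no _  = w p

    b≢w : ∀ {p} → p ∈ xs → b ≢ w p
    b≢w p∈xs ≡.refl = b-fresh (∈-++⁺ʳ forbidden (∈-map⁺ w p∈xs))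

    tail∈ : ∀ {p} → p ∈ x ∷ xs → p ≢ x → p ∈ xs
    tail∈ (here p≡x)   p≢x = contradiction p≡x p≢x
    tail∈ (there p∈xs) _   = p∈xs

    w′-choice : ∀ {p} → p ∈ x ∷ xs → w′ p ∈ choices p × w′ p ∉ forbidden
    w′-choice {p} p∈ with p ≟ᴬ x
    ... | yes ≡.refl = b∈choices , b-fresh ∘ ∈-++⁺ˡ
    ... | no p≢x     = w-choice (tail∈ p∈ p≢x)

    w′-inj : ∀ {p q} → p ∈ x ∷ xs → q ∈ x ∷ xs → w′ p ≡ w′ q → p ≡ q
    w′-inj {p} {q} p∈ q∈ eq with p ≟ᴬ x | q ≟ᴬ x
    ... | yes ≡.refl | yes ≡.refl = ≡.refl
    ... | yes _      | no q≢x     = contradiction eq (b≢w (tail∈ q∈ q≢x))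
    ... | no p≢x     | yes _      = contradiction (sym eq) (b≢w (tail∈ p∈ p≢x))
    ... | no p≢x     | no q≢x     = w-inj (tail∈ p∈ p≢x) (tail∈ q∈ q≢x) eq

  -- Hall's condition along the nested family of sublevel sets of the key suffices:
  -- the items are served greedily in increasing order of the key.
  representatives : ∀ xs → (∀ {p} → p ∈ xs → length forbidden + rank xs p ≤ length (choices p)) →
                    Representatives xs
  representatives xs room
    with representatives-descending (sort xs) (sort-descending xs)
           (λ {p} p∈ → subst (λ r → length forbidden + r ≤ length (choices p))
                         (∑-↭ (λ q → 𝟙 (key q ≤? key p)) (↭-sym (sort-↭ xs)))
                         (room (↭.∈-resp-↭ (sort-↭ xs) p∈)))
    where open Ranking key
  ... | w , w-choice , w-inj = w , w-choice ∘ back , λ p∈ q∈ → w-inj (back p∈) (back q∈)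
    where
    open Ranking key
    back : ∀ {p} → p ∈ xs → p ∈ sort xs
    back = ↭.∈-resp-↭ (↭-sym (sort-↭ xs))

-- Auxiliary sums for counting pairs and triples.

∑-single : {xs : List A} (_≟_ : DecidableEquality A) → Unique xs → ∀ x → ∑[ y ∈ xs ] 𝟙 (x ≟ y) ≤ 1
∑-single {xs = []}     _≟_ _             x = z≤n
∑-single {xs = y ∷ ys} _≟_ (y∉ys ∷ uniq) x with x ≟ y
... | no _       = ∑-single _≟_ uniq x
... | yes ≡.refl = s≤s (≤-trans (∑-mono-∈ ys none) (≤-reflexive (≡.trans (∑-const ys 0) (*-zeroʳ (length ys)))))
  where
  none : ∀ {z} → z ∈ ys → 𝟙 (x ≟ z) ≤ 0
  none {z} z∈ys with x ≟ z
  ... | yes x≡z = contradiction x≡z (All.lookup y∉ys z∈ys)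
  ... | no _    = z≤n

-- Lets the three cyclic shifts of a summand contribute equally to a sum over all triples.
∑-rotate : ∀ (xs : List A) (f : A → A → A → ℕ) →
           ∑[ x ∈ xs ] (∑[ y ∈ xs ] (∑[ z ∈ xs ] f y z x)) ≡ ∑[ x ∈ xs ] (∑[ y ∈ xs ] (∑[ z ∈ xs ] f x y z))
∑-rotate xs f = begin
  ∑[ x ∈ xs ] (∑[ y ∈ xs ] (∑[ z ∈ xs ] f y z x))   ≡⟨ ∑-comm xs xs _ ⟩
  ∑[ y ∈ xs ] (∑[ x ∈ xs ] (∑[ z ∈ xs ] f y z x))   ≡⟨ ∑-cong xs (λ y → ∑-comm xs xs _) ⟩
  ∑[ y ∈ xs ] (∑[ z ∈ xs ] (∑[ x ∈ xs ] f y z x))   ∎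
  where open ≡.≡-Reasoning

-- The distance `δ` in a tournament: triangle inequality, balls, degrees.

module TournamentProperties {n : ℕ} (T : Tournament n) where

  open Tournament T

  V : List (Fin n)
  V = allFin n

  abstract
    -- `Arc` is an arbitrary relation; off the diagonal `total` supplies a decision, which `asym`
    -- turns into a refutation when the reverse arc is present.
    arc? : ∀ u v → Dec (Arc u v)
    arc? u v with u Fin.≟ v
    ... | yes ≡.refl = no (loopless u)
    ... | no u≢v with total u v u≢v
    ...   | inj₁ uv = yes uv
    ...   | inj₂ vu = no (λ uv → asym u v uv vu)

  r : Fin n → Fin n → ℕ
  r u v = 𝟙 (arc? u v)

  ε : Fin n → Fin n → ℕ
  ε u v = 𝟙 (u Fin.≟ v)

  -- The tournament axioms as a partition of unity. Multiplying a summand by this sum splits it by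
  -- the position of one vertex relative to another.
  r-trichotomy : ∀ u v → r u v + r v u + ε u v ≡ 1
  r-trichotomy u v = exactly-one (arc? u v) (arc? v u) (u Fin.≟ v)
    where
    exactly-one : (uv? : Dec (Arc u v)) (vu? : Dec (Arc v u)) (u≡v? : Dec (u ≡ v)) → 𝟙 uv? + 𝟙 vu? + 𝟙 u≡v? ≡ 1
    exactly-one (yes uv) (yes vu) _            = contradiction vu (asym u v uv)
    exactly-one (yes uv) (no _)   (yes ≡.refl) = contradiction uv (loopless u)
    exactly-one (yes _)  (no _)   (no _)       = ≡.refl
    exactly-one (no _)   (yes vu) (yes ≡.refl) = contradiction vu (loopless u)
    exactly-one (no _)   (yes _)  (no _)       = ≡.refl
    exactly-one (no _)   (no _)   (yes _)      = ≡.refl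
    exactly-one (no ¬uv) (no ¬vu) (no u≢v) with total u v u≢v
    ... | inj₁ uv = contradiction uv ¬uv
    ... | inj₂ vu = contradiction vu ¬vu

  a : Fin n → Fin n → ℕ
  a u v = ∑[ w ∈ V ] (r u w * r w v)

  δ : Fin n → Fin n → ℕ
  δ u v = a u v + a v u

  δ-sym : ∀ u v → δ u v ≡ δ v u
  δ-sym u v = +-comm (a u v) (a v u)

  -- Indicator that `w`, different from `u` and `v`, lies in the symmetric difference of their
  -- out-neighbourhoods. The two products are never both 1, by asymmetry.
  between : Fin n → Fin n → Fin n → ℕ
  between u w v = r u w * r w v + r v w * r w u

  δ≡∑between : ∀ u v → δ u v ≡ ∑[ w ∈ V ] between u w v
  δ≡∑between u v = sym (∑-+ V _ _)

  -- A path from `u` back to `u` of length 2 would violate `asym`. Positive `δ` therefore certifies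
  -- that two vertices are distinct.
  δ-irrefl : ∀ u → δ u u ≡ 0
  δ-irrefl u = ≡.trans (δ≡∑between u u) (≡.trans (∑-cong V none) (≡.trans (∑-const V 0) (*-zeroʳ (length V))))
    where
    none : ∀ w → between u w u ≡ 0
    none w with arc? u w | arc? w u
    ... | yes uw | yes wu = contradiction wu (asym u w uw)
    ... | yes _  | no _   = ≡.refl
    ... | no _   | yes _  = ≡.refl
    ... | no _   | no _   = ≡.refl

  V! : Unique V
  V! = Unique.allFin⁺ n

  ∑ε : ∀ u → ∑[ w ∈ V ] ε u w ≤ 1
  ∑ε = ∑-single Fin._≟_ V!

  r≤1 : ∀ u v → r u v ≤ 1
  r≤1 u v = 𝟙≤1 (arc? u v)

  r+r≤1 : ∀ u v → r u v + r v u ≤ 1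
  r+r≤1 u v = subst (r u v + r v u ≤_) (r-trichotomy u v) (m≤m+n _ _)

  *≤ˡ : ∀ m {n} → n ≤ 1 → m * n ≤ m
  *≤ˡ m n≤1 = ≤-trans (*-monoʳ-≤ m n≤1) (≤-reflexive (*-identityʳ m))

  *≤ʳ : ∀ {m} n → m ≤ 1 → m * n ≤ n
  *≤ʳ n m≤1 = ≤-trans (*-monoˡ-≤ n m≤1) (≤-reflexive (*-identityˡ n))

  -- If `w` separates `v` from `v′` and differs from `u`, then `u` agrees with one of the two about
  -- `w`, and `w` separates `u` from the other one. The case `w ≡ u` is paid for by `ε u w`.
  between-triangle : ∀ u v v′ w → between v w v′ ≤ between u w v + between u w v′ + ε u w
  between-triangle u v v′ w = begin
    β                                                     ≡⟨ *-identityˡ β ⟨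
    1 * β                                                 ≡⟨ cong (_* β) (r-trichotomy u w) ⟨
    (r u w + r w u + ε u w) * β                           ≡⟨ expand (r u w) (r w u) (ε u w) β ⟩
    r u w * β + r w u * β + ε u w * β                     ≤⟨ +-mono-≤ (+-mono-≤ out inn) same ⟩
    r u w * (r w v′ + r w v) + r w u * (r v w + r v′ w) + ε u w
      ≡⟨ regroup (r u w) (r w u) (ε u w) (r v w) (r w v) (r v′ w) (r w v′) ⟩
    between u w v + between u w v′ + ε u w                ∎
    where
    open ≤-Reasoning
    β = between v w v′
    expand : ∀ p q e b → (p + q + e) * b ≡ p * b + q * b + e * b
    expand = solve-∀
    regroup : ∀ p q e s t s′ t′ → p * (t′ + t) + q * (s + s′) + e ≡ p * t + s * q + (p * t′ + s′ * q) + e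
    regroup = solve-∀
    out : r u w * β ≤ r u w * (r w v′ + r w v)
    -- When `u` beats `w`, only the arcs leaving `w` matter, so the other factor of each product is
    -- bounded by 1.
    out = *-monoʳ-≤ (r u w) (+-mono-≤ (*≤ʳ _ (r≤1 v w)) (*≤ʳ _ (r≤1 v′ w)))
    inn : r w u * β ≤ r w u * (r v w + r v′ w)
    inn = *-monoʳ-≤ (r w u) (+-mono-≤ (*≤ˡ (r v w) (r≤1 w v′)) (*≤ˡ (r v′ w) (r≤1 w v)))
    same : ε u w * β ≤ ε u w
    same = *≤ˡ _ (≤-trans (+-mono-≤ (*≤ˡ (r v w) (r≤1 w v′)) (*≤ʳ (r w v) (r≤1 v′ w))) (r+r≤1 v w))

  δ-triangle : ∀ u v v′ → δ v v′ ≤ δ u v + δ u v′ + 1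
  δ-triangle u v v′ = begin
    δ v v′                                                            ≡⟨ δ≡∑between v v′ ⟩
    ∑[ w ∈ V ] between v w v′                                         ≤⟨ ∑-mono V (between-triangle u v v′) ⟩
    ∑[ w ∈ V ] (between u w v + between u w v′ + ε u w)               ≡⟨ ∑-+ V _ (ε u) ⟩
    ∑[ w ∈ V ] (between u w v + between u w v′) + ∑ V (ε u)           ≡⟨ cong (_+ ∑ V (ε u)) (∑-+ V _ _) ⟩
    ∑[ w ∈ V ] between u w v + ∑[ w ∈ V ] between u w v′ + ∑ V (ε u)
      ≤⟨ +-mono-≤ (≤-reflexive (sym (cong₂ _+_ (δ≡∑between u v) (δ≡∑between u v′)))) (∑ε u) ⟩
    δ u v + δ u v′ + 1                                                ∎
    where open ≤-Reasoning

  -- Go round the cycle `x`, `y`, `z`: of three arcs with two possible orientations, two agree, and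
  -- as any two are adjacent on the cycle they form a path of length 2. If two of the vertices
  -- coincide, an `ε` term is 1.
  triple-between : ∀ x y z → 1 ≤ (between x y z + ε x y) + (between y z x + ε y z) + (between z x y + ε z x)
  triple-between x y z = bits (case x y) (case y z) (case z x)
    where
    -- Matching on literal 0/1 triples lets each case of the inequality evaluate to a numeral.
    data One : ℕ → ℕ → ℕ → Set where
      →₁ : One 1 0 0
      ←₁ : One 0 1 0
      =₁ : One 0 0 1

    one : ∀ {p q e} → p + q + e ≡ 1 → One p q e
    one {0} {0} {1} ≡.refl = =₁
    one {0} {1} {0} ≡.refl = ←₁
    one {1} {0} {0} ≡.refl = →₁
    one {0} {1} {suc _} ()
    one {1} {0} {suc _} ()
    one {1} {suc _} ()

    case : ∀ u v → One (r u v) (r v u) (ε u v)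
    case u v = one (r-trichotomy u v)

    bits : ∀ {p p′ e q q′ f s s′ g} → One p p′ e → One q q′ f → One s s′ g →
           1 ≤ (p * q + q′ * p′ + e) + (q * s + s′ * q′ + f) + (s * p + p′ * s′ + g)
    bits =₁ =₁ _  = s≤s z≤n
    bits =₁ →₁ →₁ = s≤s z≤n
    bits =₁ →₁ ←₁ = s≤s z≤n
    bits =₁ →₁ =₁ = s≤s z≤n
    bits =₁ ←₁ →₁ = s≤s z≤n
    bits =₁ ←₁ ←₁ = s≤s z≤n
    bits =₁ ←₁ =₁ = s≤s z≤n
    bits →₁ →₁ _  = s≤s z≤n
    bits ←₁ ←₁ _  = s≤s z≤n
    bits →₁ =₁ →₁ = s≤s z≤n
    bits →₁ =₁ ←₁ = s≤s z≤n
    bits →₁ =₁ =₁ = s≤s z≤n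
    bits ←₁ =₁ →₁ = s≤s z≤n
    bits ←₁ =₁ ←₁ = s≤s z≤n
    bits ←₁ =₁ =₁ = s≤s z≤n
    bits →₁ ←₁ →₁ = s≤s z≤n
    bits →₁ ←₁ ←₁ = s≤s z≤n
    bits →₁ ←₁ =₁ = s≤s z≤n
    bits ←₁ →₁ →₁ = s≤s z≤n
    bits ←₁ →₁ ←₁ = s≤s z≤n
    bits ←₁ →₁ =₁ = s≤s z≤n

  -- Every triple of distinct vertices contains a path of length 2, so a set of m vertices
  -- sees about m³/6 such paths, while each of its pairs is joined by at most D of them.
  clique-bound : {P : Fin n → Set} (P? : Decidable P) (D : ℕ) → let K = filter P? V in
                 (∀ {x z} → x ∈ K → z ∈ K → δ x z ≤ D) → length K ≤ 3 * (D + 1)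
  clique-bound P? D δ≤D = cancel m cubic
    where
    open ≤-Reasoning
    K = filter P? V
    m = length K

    g : Fin n → Fin n → Fin n → ℕ
    g x y z = between x y z + ε x y

    ∑³ : (Fin n → Fin n → Fin n → ℕ) → ℕ
    ∑³ f = ∑[ x ∈ K ] (∑[ y ∈ K ] (∑[ z ∈ K ] f x y z))

    ∑³-+ : ∀ f h → ∑³ (λ x y z → f x y z + h x y z) ≡ ∑³ f + ∑³ h
    ∑³-+ f h = ≡.trans (∑-cong K (λ x → ≡.trans (∑-cong K (λ y → ∑-+ K (f x y) (h x y))) (∑-+ K _ _))) (∑-+ K _ _)

    ∑³-mono : ∀ {f h} → (∀ x y z → f x y z ≤ h x y z) → ∑³ f ≤ ∑³ h
    ∑³-mono f≤h = ∑-mono K (λ x → ∑-mono K (λ y → ∑-mono K (f≤h x y)))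

    ∑³-between : ∑³ between ≤ m * (m * D)
    ∑³-between = begin
      ∑³ between                                                    ≡⟨ ∑-cong K (λ x → ∑-comm K K _) ⟩
      ∑[ x ∈ K ] (∑[ z ∈ K ] (∑[ y ∈ K ] between x y z))            ≤⟨ ∑-mono K (λ x → ∑-mono K (λ z → ∑-filter-≤ P? V _)) ⟩
      ∑[ x ∈ K ] (∑[ z ∈ K ] (∑[ y ∈ V ] between x y z))
        ≤⟨ ∑-mono-∈ K (λ x∈K → ∑-mono-∈ K (λ z∈K → ≤-trans (≤-reflexive (sym (δ≡∑between _ _))) (δ≤D x∈K z∈K))) ⟩
      ∑[ x ∈ K ] (∑[ z ∈ K ] D)                                     ≡⟨ ∑-cong K (λ _ → ∑-const K D) ⟩
      ∑[ x ∈ K ] (m * D)                                            ≡⟨ ∑-const K (m * D) ⟩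
      m * (m * D)                                                   ∎

    ∑³-ε : ∑³ (λ x y z → ε x y) ≤ m * (m * 1)
    ∑³-ε = begin
      ∑[ x ∈ K ] (∑[ y ∈ K ] (∑[ z ∈ K ] ε x y))   ≡⟨ ∑-cong K (λ x → ∑-cong K (λ y → ∑-const K (ε x y))) ⟩
      ∑[ x ∈ K ] (∑[ y ∈ K ] (m * ε x y))          ≡⟨ ∑-cong K (λ x → ∑-* K m (ε x)) ⟩
      ∑[ x ∈ K ] (m * (∑[ y ∈ K ] ε x y))
        ≤⟨ ∑-mono K (λ x → *-monoʳ-≤ m (≤-trans (∑-filter-≤ P? V (ε x)) (∑ε x))) ⟩
      ∑[ x ∈ K ] (m * 1)                           ≡⟨ ∑-const K (m * 1) ⟩
      m * (m * 1)                                  ∎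

    regroup : ∀ m D → (m * (m * D) + m * (m * 1)) + (m * (m * D) + m * (m * 1)) + (m * (m * D) + m * (m * 1))
              ≡ m * (m * (3 * (D + 1)))
    regroup = solve-∀

    ∑³-g : ∑³ g ≤ m * (m * D) + m * (m * 1)
    ∑³-g = ≤-trans (≤-reflexive (∑³-+ between (λ x y _ → ε x y))) (+-mono-≤ ∑³-between ∑³-ε)

    rotated : ∑³ (λ x y z → g y z x) ≡ ∑³ g
    rotated = ∑-rotate K g

    cubic : m * (m * m) ≤ m * (m * (3 * (D + 1)))
    cubic = begin
      m * (m * m)                                  ≡⟨ cong (λ c → m * (m * c)) (*-identityʳ m) ⟨
      m * (m * (m * 1))                            ≡⟨ ∑-const K (m * (m * 1)) ⟨
      ∑[ x ∈ K ] (m * (m * 1))                     ≡⟨ ∑-cong K (λ x → ∑-const K (m * 1)) ⟨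
      ∑[ x ∈ K ] (∑[ y ∈ K ] (m * 1))              ≡⟨ ∑-cong K (λ x → ∑-cong K (λ y → ∑-const K 1)) ⟨
      -- All ordered triples are counted, degenerate ones included; the `ε` summand of `g` covers
      -- these.
      ∑³ (λ x y z → 1)                             ≤⟨ ∑³-mono triple-between ⟩
      ∑³ (λ x y z → g x y z + g y z x + g z x y)   ≡⟨ ∑³-+ _ _ ⟩
      ∑³ (λ x y z → g x y z + g y z x) + ∑³ (λ x y z → g z x y)
        ≡⟨ cong₂ _+_ (≡.trans (∑³-+ g _) (cong (∑³ g +_) rotated))
                     (≡.trans (∑-rotate K (λ x y z → g y z x)) rotated) ⟩
      ∑³ g + ∑³ g + ∑³ g                           ≤⟨ +-mono-≤ (+-mono-≤ ∑³-g ∑³-g) ∑³-g ⟩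
      (m * (m * D) + m * (m * 1)) + (m * (m * D) + m * (m * 1)) + (m * (m * D) + m * (m * 1)) ≡⟨ regroup m D ⟩
      m * (m * (3 * (D + 1)))                      ∎

    cancel : ∀ m {c} → m * (m * m) ≤ m * (m * c) → m ≤ c
    cancel zero      _ = z≤n
    cancel m@(suc _) h = *-cancelˡ-≤ m (*-cancelˡ-≤ m h)

  -- By `δ-triangle` two points of the ball are at distance at most `d + d + 1`, so `clique-bound`
  -- applies to it.
  ball-bound : ∀ u d → ∑[ v ∈ V ] 𝟙 (δ u v ≤? d) ≤ 6 * (d + 1)
  ball-bound u d = begin
    ∑[ v ∈ V ] 𝟙 (δ u v ≤? d)   ≡⟨ length-filter≡∑ near? V ⟨
    length (filter near? V)     ≤⟨ clique-bound near? (d + d + 1) diameter ⟩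
    3 * (d + d + 1 + 1)         ≡⟨ double d ⟩
    6 * (d + 1)                 ∎
    where
    open ≤-Reasoning
    near? : Decidable (λ v → δ u v ≤ d)
    near? v = δ u v ≤? d
    near : ∀ {x} → x ∈ filter near? V → δ u x ≤ d
    near x∈ = proj₂ (∈-filter⁻ near? {xs = V} x∈)
    diameter : ∀ {x z} → x ∈ filter near? V → z ∈ filter near? V → δ x z ≤ d + d + 1
    diameter x∈ z∈ = ≤-trans (δ-triangle u _ _) (+-monoˡ-≤ 1 (+-mono-≤ (near x∈) (near z∈)))
    double : ∀ d → 3 * (d + d + 1 + 1) ≡ 6 * (d + 1)
    double = solve-∀

  deg : Fin n → ℕ
  deg u = ∑ V (r u)

  -- An out-neighbour of `u` is a common out-neighbour with `v`, a midpoint of a path from `u` to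
  -- `v`, or `v` itself.
  deg-split : ∀ u v → deg u ≡ ∑[ w ∈ V ] (r u w * r v w) + a u v + ∑[ w ∈ V ] (r u w * ε v w)
  deg-split u v = begin
    ∑[ w ∈ V ] r u w
      ≡⟨ ∑-cong V (λ w → ≡.trans (sym (*-identityʳ (r u w))) (cong (r u w *_) (sym (r-trichotomy v w)))) ⟩
    ∑[ w ∈ V ] (r u w * (r v w + r w v + ε v w))
      ≡⟨ ∑-cong V (λ w → expand (r u w) (r v w) (r w v) (ε v w)) ⟩
    ∑[ w ∈ V ] (r u w * r v w + r u w * r w v + r u w * ε v w)
      ≡⟨ ≡.trans (∑-+ V _ _) (cong (_+ (∑[ w ∈ V ] (r u w * ε v w))) (∑-+ V _ _)) ⟩
    ∑[ w ∈ V ] (r u w * r v w) + a u v + ∑[ w ∈ V ] (r u w * ε v w) ∎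
    where
    open ≡.≡-Reasoning
    expand : ∀ p q s t → p * (q + s + t) ≡ p * q + p * s + p * t
    expand = solve-∀

  -- The common out-neighbours cancel from the two degrees, leaving `a v u ≤ a u v + 1`; the 1
  -- accounts for a possible arc from `u` to `v`.
  δ≤2a+1 : ∀ u v → deg v ≤ deg u → δ u v ≤ 2 * a u v + 1
  δ≤2a+1 u v deg≤ = begin
    a u v + a v u         ≤⟨ +-monoʳ-≤ (a u v) (+-cancelˡ-≤ (∑[ w ∈ V ] (r v w * r u w)) _ _ avu) ⟩
    a u v + (a u v + 1)   ≡⟨ double (a u v) ⟩
    2 * a u v + 1         ∎
    where
    open ≤-Reasoning
    double : ∀ x → x + (x + 1) ≡ 2 * x + 1
    double = solve-∀
    avu : ∑[ w ∈ V ] (r v w * r u w) + a v u ≤ ∑[ w ∈ V ] (r v w * r u w) + (a u v + 1)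
    avu = begin
      ∑[ w ∈ V ] (r v w * r u w) + a v u
        ≤⟨ m≤m+n _ _ ⟩
      ∑[ w ∈ V ] (r v w * r u w) + a v u + ∑[ w ∈ V ] (r v w * ε u w)
        ≡⟨ deg-split v u ⟨
      deg v
        ≤⟨ deg≤ ⟩
      deg u
        ≡⟨ deg-split u v ⟩
      ∑[ w ∈ V ] (r u w * r v w) + a u v + ∑[ w ∈ V ] (r u w * ε v w)
        ≤⟨ +-mono-≤ (≤-reflexive (cong (_+ a u v) (∑-cong V (λ w → *-comm (r u w) (r v w)))))
                    (≤-trans (∑-mono V (λ w → *≤ʳ (ε v w) (r≤1 u w))) (∑ε v)) ⟩
      ∑[ w ∈ V ] (r v w * r u w) + a u v + 1
        ≡⟨ +-assoc _ (a u v) 1 ⟩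
      ∑[ w ∈ V ] (r v w * r u w) + (a u v + 1) ∎

  midpoint? : ∀ u v → Decidable (λ w → Arc u w × Arc w v)
  midpoint? u v w = arc? u w ×-dec arc? w v

  midpoints : Fin n → Fin n → List (Fin n)
  midpoints u v = filter (midpoint? u v) V

  midpoints! : ∀ u v → Unique (midpoints u v)
  midpoints! u v = Unique.filter⁺ (midpoint? u v) V!

  length-midpoints : ∀ u v → length (midpoints u v) ≡ a u v
  length-midpoints u v = ≡.trans (length-filter≡∑ (midpoint? u v) V) (∑-cong V product)
    where
    product : ∀ w → 𝟙 (midpoint? u v w) ≡ r u w * r w v
    product w with arc? u w | arc? w v
    ... | yes _ | yes _ = ≡.refl
    ... | yes _ | no _  = ≡.refl
    ... | no _  | yes _ = ≡.refl
    ... | no _  | no _  = ≡.refl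

-- Pairs of list entries, and invariance under permutation.

pairs : List A → List (A × A)
pairs []       = []
pairs (x ∷ xs) = map (x ,_) xs ++ pairs xs

∑-pairs-∷ : ∀ (f : A × A → ℕ) x xs → ∑ (pairs (x ∷ xs)) f ≡ ∑[ y ∈ xs ] f (x , y) + ∑ (pairs xs) f
∑-pairs-∷ f x xs = begin
  sum (map f (map (x ,_) xs ++ pairs xs))              ≡⟨ cong sum (map-++ f (map (x ,_) xs) (pairs xs)) ⟩
  sum (map f (map (x ,_) xs) ++ map f (pairs xs))      ≡⟨ sum-++ (map f (map (x ,_) xs)) (map f (pairs xs)) ⟩
  sum (map f (map (x ,_) xs)) + ∑ (pairs xs) f         ≡⟨ cong (λ l → sum l + ∑ (pairs xs) f) (map-∘ xs) ⟨
  ∑[ y ∈ xs ] f (x , y) + ∑ (pairs xs) f               ∎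
  where open ≡.≡-Reasoning

-- Carries pair counts from the order of greedy selection over to the order by out-degree. Symmetry
-- of `f` is what absorbs pairs that get reversed.
∑-pairs-↭ : ∀ (f : A × A → ℕ) → (∀ x y → f (x , y) ≡ f (y , x)) → {xs ys : List A} → xs ↭ ys →
            ∑ (pairs xs) f ≡ ∑ (pairs ys) f
∑-pairs-↭ f f-sym refl = ≡.refl
∑-pairs-↭ f f-sym {x ∷ xs} {_ ∷ ys} (prep _ p) = begin
  ∑ (pairs (x ∷ xs)) f                       ≡⟨ ∑-pairs-∷ f x xs ⟩
  ∑[ y ∈ xs ] f (x , y) + ∑ (pairs xs) f     ≡⟨ cong₂ _+_ (∑-↭ (λ y → f (x , y)) p) (∑-pairs-↭ f f-sym p) ⟩
  ∑[ y ∈ ys ] f (x , y) + ∑ (pairs ys) f     ≡⟨ ∑-pairs-∷ f x ys ⟨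
  ∑ (pairs (x ∷ ys)) f                       ∎
  where open ≡.≡-Reasoning
∑-pairs-↭ f f-sym {x ∷ y ∷ xs} {_ ∷ _ ∷ ys} (swap _ _ p) = begin
  ∑ (pairs (x ∷ y ∷ xs)) f
    ≡⟨ unfold x y xs ⟩
  f (x , y) + ∑[ z ∈ xs ] f (x , z) + (∑[ z ∈ xs ] f (y , z) + ∑ (pairs xs) f)
    ≡⟨ cong₂ _+_ (cong₂ _+_ (f-sym x y) (∑-↭ (λ z → f (x , z)) p))
                 (cong₂ _+_ (∑-↭ (λ z → f (y , z)) p) (∑-pairs-↭ f f-sym p)) ⟩
  f (y , x) + ∑[ z ∈ ys ] f (x , z) + (∑[ z ∈ ys ] f (y , z) + ∑ (pairs ys) f)
    ≡⟨ interchange (f (y , x)) _ _ _ ⟩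
  f (y , x) + ∑[ z ∈ ys ] f (y , z) + (∑[ z ∈ ys ] f (x , z) + ∑ (pairs ys) f)
    ≡⟨ unfold y x ys ⟨
  ∑ (pairs (y ∷ x ∷ ys)) f ∎
  where
  open ≡.≡-Reasoning
  unfold : ∀ x y xs → ∑ (pairs (x ∷ y ∷ xs)) f ≡
           f (x , y) + ∑[ z ∈ xs ] f (x , z) + (∑[ z ∈ xs ] f (y , z) + ∑ (pairs xs) f)
  unfold x y xs = ≡.trans (∑-pairs-∷ f x (y ∷ xs)) (cong (∑[ z ∈ y ∷ xs ] f (x , z) +_) (∑-pairs-∷ f y xs))
∑-pairs-↭ f f-sym (trans p q) = ≡.trans (∑-pairs-↭ f f-sym p) (∑-pairs-↭ f f-sym q)

-- The quadratic potential.

-- For `m ≤ z` this is the expansion of a square, with equality. Otherwise the truncated difference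
-- vanishes and what remains is that `(m ∸ z)` has a nonnegative square.
∸-square : ∀ z m → (z ∸ m) * (z ∸ m) + 2 * m * z ≤ z * z + m * m
∸-square z m with ≤-total m z
... | inj₁ m≤z = ≤-reflexive (begin
    (z ∸ m) * (z ∸ m) + 2 * m * z                           ≡⟨ cong (λ x → (z ∸ m) * (z ∸ m) + 2 * m * x) (m+[n∸m]≡n m≤z) ⟨
    (z ∸ m) * (z ∸ m) + 2 * m * (m + (z ∸ m))               ≡⟨ square m (z ∸ m) ⟩
    (m + (z ∸ m)) * (m + (z ∸ m)) + m * m                   ≡⟨ cong (λ x → x * x + m * m) (m+[n∸m]≡n m≤z) ⟩
    z * z + m * m                                           ∎)
  where
  open ≡.≡-Reasoning
  square : ∀ m q → q * q + 2 * m * (m + q) ≡ (m + q) * (m + q) + m * m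
  square = solve-∀
... | inj₂ z≤m = begin
    (z ∸ m) * (z ∸ m) + 2 * m * z                           ≡⟨ cong (λ x → x * x + 2 * m * z) (m≤n⇒m∸n≡0 z≤m) ⟩
    2 * m * z                                               ≤⟨ m≤m+n _ ((m ∸ z) * (m ∸ z)) ⟩
    2 * m * z + (m ∸ z) * (m ∸ z)                           ≡⟨ cong (λ x → 2 * x * z + (m ∸ z) * (m ∸ z)) (m+[n∸m]≡n z≤m) ⟨
    2 * (z + (m ∸ z)) * z + (m ∸ z) * (m ∸ z)               ≡⟨ square z (m ∸ z) ⟩
    z * z + (z + (m ∸ z)) * (z + (m ∸ z))                   ≡⟨ cong (λ x → z * z + x * x) (m+[n∸m]≡n z≤m) ⟩
    z * z + m * m                                           ∎
  where
  open ≤-Reasoning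
  square : ∀ z q → 2 * (z + q) * z + q * q ≡ z * z + (z + q) * (z + q)
  square = solve-∀

-- One scale, one new vertex: the count rises by `δ` and the threshold by `m`. Apply `∸-square` at
-- `δ + y`, then linearise by `m * m ≤ k * m` and `δ * δ ≤ k * δ`. The right side is now affine in
-- `δ`, so a bound on the average of `δ` can be inserted.
excess-step : ∀ k m x s δ → m ≤ k → δ ≤ k → let y = x ∸ s; y′ = (δ + x) ∸ (m + s) in
              y′ * y′ + 2 * m * y ≤ (y * y + k * m) + (2 * y + k) * δ
excess-step k m x s δ m≤k δ≤k = begin
  y′ * y′ + 2 * m * y
    ≤⟨ +-mono-≤ (*-mono-≤ y′≤ y′≤) (*-monoʳ-≤ (2 * m) (m≤n+m y δ)) ⟩
  (δ + y ∸ m) * (δ + y ∸ m) + 2 * m * (δ + y)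
    ≤⟨ ∸-square (δ + y) m ⟩
  (δ + y) * (δ + y) + m * m
    ≡⟨ expand δ y m ⟩
  (y * y + m * m) + (2 * y * δ + δ * δ)
    ≤⟨ +-mono-≤ (+-monoʳ-≤ (y * y) (*-monoˡ-≤ m m≤k)) (+-monoʳ-≤ (2 * y * δ) (*-monoˡ-≤ δ δ≤k)) ⟩
  (y * y + k * m) + (2 * y * δ + k * δ)
    ≡⟨ cong (y * y + k * m +_) (*-distribʳ-+ δ (2 * y) k) ⟨
  (y * y + k * m) + (2 * y + k) * δ ∎
  where
  open ≤-Reasoning
  y  = x ∸ s
  y′ = (δ + x) ∸ (m + s)
  y′≤ : y′ ≤ δ + y ∸ m
  y′≤ = begin
    δ + x ∸ (m + s)   ≡⟨ cong (δ + x ∸_) (+-comm m s) ⟩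
    δ + x ∸ (s + m)   ≡⟨ ∸-+-assoc (δ + x) s m ⟨
    δ + x ∸ s ∸ m     ≤⟨ ∸-monoˡ-≤ m (m≤n+o⇒m∸n≤o (δ + x) s
                           (≤-trans (+-monoʳ-≤ δ (m≤n+m∸n x s)) (≤-reflexive (rotate δ s y)))) ⟩
    δ + y ∸ m         ∎
    where
    rotate : ∀ a b c → a + (b + c) ≡ b + (a + c)
    rotate = solve-∀
  expand : ∀ δ y m → (δ + y) * (δ + y) + m * m ≡ (y * y + m * m) + (2 * y * δ + δ * δ)
  expand = solve-∀

-- As `δ` averages at most `m`, the drift `2 * y * δ` is compensated by the term `2 * m * y` on the
-- left. What survives is a variance of `2 * k * m` per vertex, independent of the current excess.
∑-excess : ∀ (G : List A) k m x s (δ : A → ℕ) → m ≤ k → (∀ v → δ v ≤ k) → ∑ G δ ≤ length G * m →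
           ∑[ v ∈ G ] ((δ v + x ∸ (m + s)) * (δ v + x ∸ (m + s))) ≤ length G * ((x ∸ s) * (x ∸ s) + 2 * k * m)
∑-excess G k m x s δ m≤k δ≤k ∑δ≤ = +-cancelʳ-≤ (g * (2 * m * y)) _ _ (begin
  ∑[ v ∈ G ] (y′ v * y′ v) + g * (2 * m * y)                    ≡⟨ cong (∑[ v ∈ G ] (y′ v * y′ v) +_) (∑-const G (2 * m * y)) ⟨
  ∑[ v ∈ G ] (y′ v * y′ v) + ∑[ v ∈ G ] (2 * m * y)             ≡⟨ ∑-+ G _ _ ⟨
  ∑[ v ∈ G ] (y′ v * y′ v + 2 * m * y)                          ≤⟨ ∑-mono G (λ v → excess-step k m x s (δ v) m≤k (δ≤k v)) ⟩
  ∑[ v ∈ G ] ((y * y + k * m) + (2 * y + k) * δ v)              ≡⟨ ∑-+ G _ _ ⟩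
  ∑[ v ∈ G ] (y * y + k * m) + ∑[ v ∈ G ] ((2 * y + k) * δ v)   ≡⟨ cong₂ _+_ (∑-const G _) (∑-* G (2 * y + k) δ) ⟩
  g * (y * y + k * m) + (2 * y + k) * ∑ G δ                     ≤⟨ +-monoʳ-≤ _ (*-monoʳ-≤ (2 * y + k) ∑δ≤) ⟩
  g * (y * y + k * m) + (2 * y + k) * (g * m)                   ≡⟨ regroup g y k m ⟩
  g * (y * y + 2 * k * m) + g * (2 * m * y)                     ∎)
  where
  open ≤-Reasoning
  g = length G
  y = x ∸ s
  y′ : _ → ℕ
  y′ v = δ v + x ∸ (m + s)
  regroup : ∀ g y k m → g * (y * y + k * m) + (2 * y + k) * (g * m) ≡ g * (y * y + 2 * k * m) + g * (2 * m * y)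
  regroup = solve-∀

-- 4^(J-1) times the sum over j < J of the squares of (X j − t 2^j)⁺ / 2^j: a one-sided
-- second moment, which bounds all dyadic scales j at the cost of a convergent series.
energy : (ℕ → ℕ) → ℕ → ℕ → ℕ
energy X t zero    = 0
energy X t (suc J) = 4 * energy X t J + (X J ∸ t * 2 ^ J) * (X J ∸ t * 2 ^ J)

-- The average growth of `energy` allowed per added vertex, with the same weights: `4^(J-1)` times
-- the sum of `2k / 2^j` over `j < J`, a geometric series.
budget : ℕ → ℕ → ℕ
budget k zero    = 0
budget k (suc J) = 4 * budget k J + 2 * k * 2 ^ J

-- `∑-excess` is summed over the scales with `m = 2 ^ j`. Because one average controls the weighted
-- total, a single vertex can later serve all scales simultaneously.
∑-energy : ∀ (G : List A) k t (X : ℕ → ℕ) (δ : ℕ → A → ℕ) J →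
           (∀ j → j < J → 2 ^ j ≤ k) → (∀ j v → δ j v ≤ k) → (∀ j → ∑ G (δ j) ≤ length G * 2 ^ j) →
           ∑[ v ∈ G ] energy (λ j → δ j v + X j) (suc t) J ≤ length G * (energy X t J + budget k J)
∑-energy G k t X δ zero    2^≤k δ≤k ∑δ≤ = ≤-reflexive (∑-const G 0)
∑-energy G k t X δ (suc J) 2^≤k δ≤k ∑δ≤ = begin
  ∑[ v ∈ G ] (4 * e v + q v)                         ≡⟨ ∑-+ G _ _ ⟩
  ∑[ v ∈ G ] (4 * e v) + ∑ G q                       ≡⟨ cong (_+ ∑ G q) (∑-* G 4 e) ⟩
  4 * ∑ G e + ∑ G q
    ≤⟨ +-mono-≤ (*-monoʳ-≤ 4 (∑-energy G k t X δ J (λ j j<J → 2^≤k j (m<n⇒m<1+n j<J)) δ≤k ∑δ≤))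
                (∑-excess G k (2 ^ J) (X J) (t * 2 ^ J) (δ J) (2^≤k J (n<1+n J)) (δ≤k J) (∑δ≤ J)) ⟩
  4 * (g * (energy X t J + budget k J)) + g * (Y * Y + 2 * k * 2 ^ J)
    ≡⟨ regroup g (energy X t J) (budget k J) (Y * Y) (2 * k * 2 ^ J) ⟩
  g * (energy X t (suc J) + budget k (suc J))        ∎
  where
  open ≤-Reasoning
  g = length G
  Y = X J ∸ t * 2 ^ J
  e q : _ → ℕ
  e v = energy (λ j → δ j v + X j) (suc t) J
  q v = (δ J v + X J ∸ suc t * 2 ^ J) * (δ J v + X J ∸ suc t * 2 ^ J)
  regroup : ∀ g e b y c → 4 * (g * (e + b)) + g * (y + c) ≡ g * (4 * e + y + (4 * b + c))
  regroup = solve-∀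

energy-zero : ∀ J → energy (λ _ → 0) 0 J ≡ 0
energy-zero zero    = ≡.refl
energy-zero (suc J) rewrite energy-zero J = ≡.refl

budget≤ : ∀ k J → budget k J ≤ k * 4 ^ J
budget≤ k J = m+n≤o⇒m≤o (budget k J) (total J)
  where
  open ≤-Reasoning
  regroup₁ : ∀ b k p → 4 * b + 2 * k * p + k * (2 * p) ≡ 4 * (b + k * p)
  regroup₁ = solve-∀
  regroup₂ : ∀ k q → 4 * (k * q) ≡ k * (4 * q)
  regroup₂ = solve-∀
  -- The extra term `k * 2 ^ J` strengthens the claim so that the induction closes.
  total : ∀ J → budget k J + k * 2 ^ J ≤ k * 4 ^ J
  total zero    = ≤-refl
  total (suc J) = begin
    4 * budget k J + 2 * k * 2 ^ J + k * (2 * 2 ^ J)   ≡⟨ regroup₁ (budget k J) k (2 ^ J) ⟩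
    4 * (budget k J + k * 2 ^ J)                       ≤⟨ *-monoʳ-≤ 4 (total J) ⟩
    4 * (k * 4 ^ J)                                    ≡⟨ regroup₂ k (4 ^ J) ⟩
    k * (4 * 4 ^ J)                                    ∎

-- Scale `j` enters the energy with weight `4^(J-1-j)`; all other terms are nonnegative and are
-- dropped.
energy-bounds-excess : ∀ X t J K → energy X t J ≤ K * 4 ^ J → ∀ {j} → j < J →
                       (X j ∸ t * 2 ^ j) * (X j ∸ t * 2 ^ j) ≤ K * 4 ^ suc j
energy-bounds-excess X t (suc J) K h {j} (s≤s j≤J) with m≤n⇒m<n∨m≡n j≤J
... | inj₂ ≡.refl = ≤-trans (m≤n+m _ (4 * energy X t J)) h
... | inj₁ j<J    = energy-bounds-excess X t J K (*-cancelˡ-≤ 4 (begin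
    4 * energy X t J                                   ≤⟨ m≤m+n _ _ ⟩
    energy X t (suc J)                                 ≤⟨ h ⟩
    K * (4 * 4 ^ J)                                    ≡⟨ regroup K (4 ^ J) ⟩
    4 * (K * 4 ^ J)                                    ∎)) j<J
  where
  open ≤-Reasoning
  regroup : ∀ k q → k * (4 * q) ≡ 4 * (k * q)
  regroup = solve-∀

4^≡2^*2^ : ∀ j → 4 ^ j ≡ 2 ^ j * 2 ^ j
4^≡2^*2^ zero    = ≡.refl
4^≡2^*2^ (suc j) = ≡.trans (cong (4 *_) (4^≡2^*2^ j)) (regroup (2 ^ j))
  where
  regroup : ∀ p → 4 * (p * p) ≡ 2 * p * (2 * p)
  regroup = solve-∀

square-cancel-≤ : ∀ {m n} → m * m ≤ n * n → m ≤ n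
square-cancel-≤ {m} {n} h with m ≤? n
... | yes m≤n = m≤n
... | no m≰n  = contradiction h (<⇒≱ (*-mono-< (≰⇒> m≰n) (≰⇒> m≰n)))

-- With `K = k * k` the excess over `k * 2 ^ j` is at most the square root of `k² 4^(j+1)`, which is
-- `2 * k * 2 ^ j`.
energy⇒bound : ∀ X k J → energy X k J ≤ k * budget k J → ∀ {j} → j < J → X j ≤ 3 * k * 2 ^ j
energy⇒bound X k J h {j} j<J = begin
  X j                                      ≤⟨ m≤n+m∸n (X j) (k * 2 ^ j) ⟩
  k * 2 ^ j + (X j ∸ k * 2 ^ j)            ≤⟨ +-monoʳ-≤ (k * 2 ^ j) (square-cancel-≤ square) ⟩
  k * 2 ^ j + 2 * k * 2 ^ j                ≡⟨ regroup k (2 ^ j) ⟩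
  3 * k * 2 ^ j                            ∎
  where
  open ≤-Reasoning
  regroup : ∀ k p → k * p + 2 * k * p ≡ 3 * k * p
  regroup = solve-∀
  scale : ∀ k p → k * k * (4 * (p * p)) ≡ 2 * k * p * (2 * k * p)
  scale = solve-∀
  square : (X j ∸ k * 2 ^ j) * (X j ∸ k * 2 ^ j) ≤ 2 * k * 2 ^ j * (2 * k * 2 ^ j)
  square = begin
    (X j ∸ k * 2 ^ j) * (X j ∸ k * 2 ^ j)
      ≤⟨ energy-bounds-excess X k J (k * k)
           (≤-trans h (≤-trans (*-monoʳ-≤ k (budget≤ k J)) (≤-reflexive (sym (*-assoc k k (4 ^ J)))))) j<J ⟩
    k * k * (4 * 4 ^ j)                      ≡⟨ cong (λ p → k * k * (4 * p)) (4^≡2^*2^ j) ⟩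
    k * k * (4 * (2 ^ j * 2 ^ j))            ≡⟨ scale k (2 ^ j) ⟩
    2 * k * 2 ^ j * (2 * k * 2 ^ j)          ∎

-- Greedy selection of a set sparse at all scales.

module Selection (V : List A) (near : ℕ → A × A → ℕ) (near≤1 : ∀ j p → near j p ≤ 1)
                 (k J M : ℕ) (0<k : 0 < k) (0<M : 0 < M) (2^≤k : ∀ j → j < J → 2 ^ j ≤ k)
                 (volume : ∀ j u → ∑[ v ∈ V ] near j (v , u) ≤ M * 2 ^ j)
                 (large : 2 * (k * M) ≤ length V) where

  load : ℕ → List A → A → ℕ
  load j S v = ∑[ u ∈ S ] near j (v , u)

  crowd : List A → ℕ → ℕ
  crowd S j = ∑ (pairs S) (near j)

  Good : ℕ → List A → Set
  Good t S = length S ≡ t × crowd S 0 ≡ 0 × energy (crowd S) t J ≤ t * budget k J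

  load≤ : ∀ j S v → load j S v ≤ length S
  load≤ j S v = ≤-trans (∑-mono S (λ u → near≤1 j (v , u))) (≤-reflexive (≡.trans (∑-const S 1) (*-identityʳ _)))

  ∑load≤ : ∀ j S → length S ≤ k → ∑ V (load j S) ≤ k * M * 2 ^ j
  ∑load≤ j S S≤k = begin
    ∑[ v ∈ V ] (∑[ u ∈ S ] near j (v , u))   ≡⟨ ∑-comm V S _ ⟩
    ∑[ u ∈ S ] (∑[ v ∈ V ] near j (v , u))   ≤⟨ ∑-mono S (volume j) ⟩
    ∑[ u ∈ S ] (M * 2 ^ j)                   ≡⟨ ∑-const S (M * 2 ^ j) ⟩
    length S * (M * 2 ^ j)                   ≤⟨ *-monoˡ-≤ (M * 2 ^ j) S≤k ⟩
    k * (M * 2 ^ j)                          ≡⟨ *-assoc k M (2 ^ j) ⟨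
    k * M * 2 ^ j                            ∎
    where open ≤-Reasoning

  energy-cong : ∀ {X Y : ℕ → ℕ} t J → (∀ j → X j ≡ Y j) → energy X t J ≡ energy Y t J
  energy-cong t zero    X≡Y = ≡.refl
  energy-cong t (suc J) X≡Y rewrite energy-cong t J X≡Y | X≡Y J = ≡.refl

  -- At most `k * M` vertices are near `S` at scale 0, so at least `k * M` remain in `G`. The total
  -- load `k * M * 2 ^ j` then averages to at most `2 ^ j` on `G`, as `∑-energy` requires, and some
  -- `v` in `G` raises the energy by no more than one budget. Membership in `G` keeps scale 0 empty.
  extend : ∀ t S → t < k → Good t S → ∃ (Good (suc t))
  extend t S t<k (|S|≡t , crowd≡0 , energy≤)
    with ∑≤average G (λ v → energy (λ j → load j S v + crowd S j) (suc t) J) (energy (crowd S) t J + budget k J)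
           (≤-trans (*-mono-≤ 0<k 0<M) kM≤G)
           (∑-energy G k t (crowd S) (λ j → load j S) J 2^≤k (λ j v → ≤-trans (load≤ j S v) S≤k) ∑G≤)
    where
    open ≤-Reasoning
    S≤k : length S ≤ k
    S≤k = ≤-trans (≤-reflexive |S|≡t) (<⇒≤ t<k)

    far? : Decidable (λ v → load 0 S v ≡ 0)
    far? v = load 0 S v ≟ 0

    G : List A
    G = filter far? V

    1≤𝟙+ : ∀ x → 1 ≤ 𝟙 (x ≟ 0) + x
    1≤𝟙+ zero    = ≤-refl
    1≤𝟙+ (suc x) = m≤n⇒m≤o+n (𝟙 (suc x ≟ 0)) (s≤s z≤n)

    kM≤G : k * M ≤ length G
    kM≤G = +-cancelʳ-≤ (k * M) _ _ (begin
      k * M + k * M                                    ≡⟨ cong (k * M +_) (+-identityʳ (k * M)) ⟨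
      2 * (k * M)                                      ≤⟨ large ⟩
      length V                                         ≡⟨ ≡.trans (∑-const V 1) (*-identityʳ _) ⟨
      -- A vertex outside `G` has load at least 1, so the total load bounds the number of discarded
      -- vertices.
      ∑[ v ∈ V ] 1                                     ≤⟨ ∑-mono V (λ v → 1≤𝟙+ (load 0 S v)) ⟩
      ∑[ v ∈ V ] (𝟙 (far? v) + load 0 S v)             ≡⟨ ∑-+ V _ _ ⟩
      ∑[ v ∈ V ] 𝟙 (far? v) + ∑ V (load 0 S)           ≡⟨ cong (_+ ∑ V (load 0 S)) (length-filter≡∑ far? V) ⟨
      length G + ∑ V (load 0 S)                        ≤⟨ +-monoʳ-≤ (length G) (∑load≤ 0 S S≤k) ⟩
      length G + k * M * 1                             ≡⟨ cong (length G +_) (*-identityʳ (k * M)) ⟩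
      length G + k * M                                 ∎)

    ∑G≤ : ∀ j → ∑ G (load j S) ≤ length G * 2 ^ j
    ∑G≤ j = begin
      ∑ G (load j S)      ≤⟨ ∑-filter-≤ far? V (load j S) ⟩
      ∑ V (load j S)      ≤⟨ ∑load≤ j S S≤k ⟩
      k * M * 2 ^ j       ≤⟨ *-monoˡ-≤ (2 ^ j) kM≤G ⟩
      length G * 2 ^ j    ∎
  ... | v , v∈G , energy′≤ = v ∷ S , cong suc |S|≡t , crowd′≡0 , (begin
      energy (crowd (v ∷ S)) (suc t) J                        ≡⟨ energy-cong (suc t) J (λ j → ∑-pairs-∷ (near j) v S) ⟩
      energy (λ j → load j S v + crowd S j) (suc t) J         ≤⟨ energy′≤ ⟩
      energy (crowd S) t J + budget k J                       ≤⟨ +-monoˡ-≤ (budget k J) energy≤ ⟩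
      t * budget k J + budget k J                             ≡⟨ +-comm (t * budget k J) (budget k J) ⟩
      suc t * budget k J                                      ∎)
    where
    open ≤-Reasoning
    crowd′≡0 : crowd (v ∷ S) 0 ≡ 0
    crowd′≡0 = ≡.trans (∑-pairs-∷ (near 0) v S)
                       (cong₂ _+_ (proj₂ (∈-filter⁻ (λ u → load 0 S u ≟ 0) {xs = V} v∈G)) crowd≡0)

  good : ∀ t → t ≤ k → ∃ (Good t)
  good zero    _   = [] , ≡.refl , ≡.refl , ≤-reflexive (energy-zero J)
  good (suc t) t<k = let S , S-good = good t (<⇒≤ t<k) in extend t S t<k S-good

  sparse-set : ∃[ S ] (length S ≡ k × crowd S 0 ≡ 0 × (∀ {j} → j < J → crowd S j ≤ 3 * k * 2 ^ j))
  sparse-set with good k ≤-refl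
  ... | S , |S|≡k , crowd≡0 , energy≤ = S , |S|≡k , crowd≡0 , energy⇒bound (crowd S) k J energy≤

-- Pair lists and dyadic scales.

length-pairs≤ : ∀ (xs : List A) → length (pairs xs) ≤ length xs * length xs
length-pairs≤ []       = z≤n
length-pairs≤ (x ∷ xs) = begin
  length (map (x ,_) xs ++ pairs xs)          ≡⟨ length-++ (map (x ,_) xs) ⟩
  length (map (x ,_) xs) + length (pairs xs)  ≤⟨ +-mono-≤ (≤-reflexive (length-map (x ,_) xs)) (length-pairs≤ xs) ⟩
  length xs + length xs * length xs           ≡⟨ *-suc (length xs) (length xs) ⟨
  length xs * suc (length xs)                 ≤⟨ m≤n+m _ (suc (length xs)) ⟩
  suc (length xs) * suc (length xs)           ∎
  where open ≤-Reasoning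

AllPairs⇒All-pairs : {R : A → A → Set} {xs : List A} → AllPairs R xs → All (λ p → R (proj₁ p) (proj₂ p)) (pairs xs)
AllPairs⇒All-pairs []       = []
AllPairs⇒All-pairs (h ∷ hs) = All.++⁺ (All.map⁺ h) (AllPairs⇒All-pairs hs)

lookup-∈-pairs : ∀ (xs : List A) {i j} → i Fin.< j → (lookup xs i , lookup xs j) ∈ pairs xs
lookup-∈-pairs (x ∷ xs) {Fin.zero}  {Fin.suc j} _         = ∈-++⁺ˡ (∈-map⁺ (x ,_) (∈-lookup {xs = xs} j))
lookup-∈-pairs (x ∷ xs) {Fin.suc i} {Fin.suc j} (s≤s i<j) = ∈-++⁺ʳ (map (x ,_) xs) (lookup-∈-pairs xs i<j)

∈⇒≤∑ : ∀ {xs : List A} (f : A → ℕ) {x} → x ∈ xs → f x ≤ ∑ xs f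
∈⇒≤∑ f (here ≡.refl) = m≤m+n (f _) _
∈⇒≤∑ f (there x∈xs)  = m≤n⇒m≤o+n (f _) (∈⇒≤∑ f x∈xs)

-- `J` is the least exponent with `k ≤ 2 ^ J`. The upper bound lets the last scale absorb all pairs;
-- the lower bounds are the condition `m ≤ k` of `∑-excess`.
dyadic-scale : ∀ k → ∃[ J ] (k ≤ 2 ^ J × (∀ j → j < J → 2 ^ j ≤ k))
dyadic-scale zero    = 0 , z≤n , λ _ ()
dyadic-scale (suc k) with dyadic-scale k
... | J , k≤2^J , 2^≤k with suc k ≤? 2 ^ J
...   | yes k<2^J = J , k<2^J , λ j j<J → m≤n⇒m≤1+n (2^≤k j j<J)
...   | no k≮2^J  = suc J , sk≤ , below
  where
  sk≤ : suc k ≤ 2 * 2 ^ J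
  sk≤ = ≤-trans (≤-reflexive (+-comm 1 k)) (+-mono-≤ k≤2^J (≤-trans (m^n>0 2 J) (≤-reflexive (sym (+-identityʳ _)))))
  below : ∀ j → j < suc J → 2 ^ j ≤ suc k
  below j (s≤s j≤J) = ≤-trans (^-monoʳ-≤ 2 j≤J) (<⇒≤ (≰⇒> k≮2^J))

locate : ∀ (θ : ℕ → ℕ) x J → θ 0 < x → (∃[ j ] (j < J × θ j < x × x ≤ θ (suc j))) ⊎ θ J < x
locate θ x zero    θ0<x = inj₂ θ0<x
locate θ x (suc J) θ0<x with locate θ x J θ0<x
... | inj₁ (j , j<J , lo , hi) = inj₁ (j , m<n⇒m<1+n j<J , lo , hi)
... | inj₂ θJ<x with x ≤? θ (suc J)
...   | yes x≤ = inj₁ (J , n<1+n J , θJ<x , x≤)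
...   | no x≰  = inj₂ (≰⇒> x≰)

-- Embedding the subdivision.

module Embedding {n : ℕ} (T : Tournament n) where

  open TournamentProperties T

  δ′ a′ : Fin n × Fin n → ℕ
  δ′ (u , v) = δ u v
  a′ (u , v) = a u v

  pairRank : List (Fin n) → Fin n × Fin n → ℕ
  pairRank S p = ∑[ q ∈ pairs S ] 𝟙 (δ′ q ≤? δ′ p)

  -- The branch vertices are the entries of `S`, distinct since `δ` is positive on pairs. The
  -- subdivision vertices are distinct representatives of the midpoint sets, avoiding `S`.
  embed : ∀ S → (∀ {p} → p ∈ pairs S → 0 < δ′ p) →
          (∀ {p} → p ∈ pairs S → length S + pairRank S p ≤ a′ p) → ContainsCopy T (H (length S))
  embed S δ>0 room
    with representatives (≡-dec Fin._≟_ Fin._≟_) Fin._≟_ δ′ (λ (u , v) → midpoints u v) (λ (u , v) → midpoints! u v)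
           S proj₁ (pairs S) (λ p∈ → ≤-trans (room p∈) (≤-reflexive (sym (length-midpoints _ _))))
  ... | w , w-choice , w-inj = φ , φ-inj _ _ , φ-arc
    where
    φ : HVertex (length S) → Fin n
    φ (inj₁ i)             = lookup S i
    φ (inj₂ ((i , j) , _)) = w (lookup S i , lookup S j)

    lookup-inj : ∀ i j → lookup S i ≡ lookup S j → i ≡ j
    lookup-inj i j eq with Fin.<-cmp i j
    ... | tri≈ _ i≡j _ = i≡j
    ... | tri< i<j _ _ = contradiction (≡.trans (cong (λ v → δ v (lookup S j)) eq) (δ-irrefl (lookup S j)))
                                       (>⇒≢ (δ>0 (lookup-∈-pairs S i<j)))
    ... | tri> _ _ j<i = contradiction (≡.trans (cong (δ (lookup S j)) eq) (δ-irrefl (lookup S j)))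
                                       (>⇒≢ (δ>0 (lookup-∈-pairs S j<i)))

    w∉S : ∀ {i j k} → j Fin.< k → lookup S i ≢ w (lookup S j , lookup S k)
    w∉S {i} j<k eq = proj₂ (w-choice (lookup-∈-pairs S j<k)) (subst (_∈ S) eq (∈-lookup i))

    φ-inj : ∀ x y → φ x ≡ φ y → x ≡ y
    φ-inj (inj₁ i) (inj₁ j) eq = cong inj₁ (lookup-inj i j eq)
    φ-inj (inj₁ i) (inj₂ (_ , j<k)) eq = contradiction eq (w∉S j<k)
    φ-inj (inj₂ (_ , j<k)) (inj₁ i) eq = contradiction (sym eq) (w∉S j<k)
    φ-inj (inj₂ ((i , j) , i<j)) (inj₂ ((i′ , j′) , i′<j′)) eq
      with w-inj (lookup-∈-pairs S i<j) (lookup-∈-pairs S i′<j′) eq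
    ... | eq′ with lookup-inj i i′ (cong proj₁ eq′) | lookup-inj j j′ (cong proj₂ eq′)
    -- A subdivision vertex carries a proof of `i < j`, so injectivity also needs these proofs to be
    -- equal.
    ...   | ≡.refl | ≡.refl = cong (λ lt → inj₂ ((i , j) , lt)) (≤-irrelevant i<j i′<j′)

    path : ∀ {i j} → i Fin.< j → let u = lookup S i; v = lookup S j in
           Tournament.Arc T u (w (u , v)) × Tournament.Arc T (w (u , v)) v
    path i<j = proj₂ (∈-filter⁻ (midpoint? _ _) {xs = V} (proj₁ (w-choice (lookup-∈-pairs S i<j))))

    φ-arc : ∀ x y → HArc (length S) x y → Tournament.Arc T (φ x) (φ y)
    φ-arc (inj₁ _) (inj₂ (_ , i<j)) ≡.refl = proj₁ (path i<j)
    φ-arc (inj₂ (_ , i<j)) (inj₁ _) ≡.refl = proj₂ (path i<j)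

  module _ (k : ℕ) (1<k : 1 < k) (large : 384 * (k * k) ≤ n) where

    -- The factor 16 makes `δ > θ j` force `a ≥ 8 * k * 2 ^ j`, enough for the `k` branch vertices
    -- and the `3 * k * 2 ^ suc j` competing pairs.
    θ : ℕ → ℕ
    θ j = 16 * k * 2 ^ j

    near : ℕ → Fin n × Fin n → ℕ
    near j p = 𝟙 (δ′ p ≤? θ j)

    near-sym : ∀ j u v → near j (u , v) ≡ near j (v , u)
    near-sym j u v = cong (λ d → 𝟙 (d ≤? θ j)) (δ-sym u v)

    θ>0 : ∀ j → 0 < θ j
    θ>0 j = *-mono-≤ {1} {16 * k} (≤-trans (<⇒≤ 1<k) (m≤m+n k _)) (m^n>0 2 j)

    near-volume : ∀ j u → ∑[ v ∈ V ] near j (v , u) ≤ 192 * k * 2 ^ j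
    near-volume j u = begin
      ∑[ v ∈ V ] near j (v , u)   ≡⟨ ∑-cong V (λ v → near-sym j v u) ⟩
      ∑[ v ∈ V ] near j (u , v)   ≤⟨ ball-bound u (θ j) ⟩
      -- Absorbing the 1 into a second `θ j` gives `12 * 16 = 192`, hence `M = 192 * k` and
      -- `n ≥ 2 * k * M = 384 * (k * k)`.
      6 * (θ j + 1)               ≤⟨ *-monoʳ-≤ 6 (+-monoʳ-≤ (θ j) (θ>0 j)) ⟩
      6 * (θ j + θ j)             ≡⟨ regroup k (2 ^ j) ⟩
      192 * k * 2 ^ j             ∎
      where
      open ≤-Reasoning
      regroup : ∀ k p → 6 * (16 * k * p + 16 * k * p) ≡ 192 * k * p
      regroup = solve-∀

    |V|-large : 2 * (k * (192 * k)) ≤ length V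
    |V|-large = begin
      2 * (k * (192 * k))   ≡⟨ regroup k ⟩
      384 * (k * k)         ≤⟨ large ⟩
      n                     ≡⟨ length-tabulate id ⟨
      length V              ∎
      where
      open ≤-Reasoning
      regroup : ∀ k → 2 * (k * (192 * k)) ≡ 384 * (k * k)
      regroup = solve-∀

    half : ∀ {x} y → 2 * x < 2 * y + 1 → x ≤ y
    half y h = *-cancelˡ-≤ 2 (≤-pred (≤-trans h (≤-reflexive (+-comm (2 * y) 1))))

    module _ (J′ : ℕ) (S₀ : List (Fin n)) (k≤2^J : k ≤ 2 ^ suc J′) (|S₀|≡k : length S₀ ≡ k)
             (isolated₀ : ∑ (pairs S₀) (near 0) ≡ 0)
             (sparse₀ : ∀ {j} → j < suc J′ → ∑ (pairs S₀) (near j) ≤ 3 * k * 2 ^ j) where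

      open ≤-Reasoning
      open Ranking deg

      S : List (Fin n)
      S = sort S₀

      |S|≡k : length S ≡ k
      |S|≡k = ≡.trans (↭.↭-length (sort-↭ S₀)) |S₀|≡k

      crowd : ℕ → ℕ
      crowd j = ∑ (pairs S) (near j)

      crowd≡ : ∀ j → crowd j ≡ ∑ (pairs S₀) (near j)
      crowd≡ j = ∑-pairs-↭ (near j) (near-sym j) (sort-↭ S₀)

      θ0<δ : ∀ {p} → p ∈ pairs S → θ 0 < δ′ p
      θ0<δ {p} p∈ = ≰⇒> (λ δ≤ → contradiction
        (≤-trans (≤-reflexive (sym (𝟙-yes (δ′ p ≤? θ 0) δ≤)))
                 (≤-trans (∈⇒≤∑ (near 0) p∈) (≤-reflexive (≡.trans (crowd≡ 0) isolated₀)))) λ ())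

      δ>0 : ∀ {p} → p ∈ pairs S → 0 < δ′ p
      δ>0 p∈ = ≤-trans (s≤s z≤n) (θ0<δ p∈)

      -- Sorting puts the larger out-degree first in each pair, so `δ≤2a+1` applies; `half` absorbs
      -- its additive 1.
      a-large : ∀ {p} → p ∈ pairs S → ∀ j → θ j < δ′ p → 8 * k * 2 ^ j ≤ a′ p
      a-large {p} p∈ j θ<δ = half (a′ p) (begin-strict
        2 * (8 * k * 2 ^ j)   ≡⟨ regroup k (2 ^ j) ⟩
        θ j                   <⟨ θ<δ ⟩
        δ′ p                  ≤⟨ δ≤2a+1 _ _ (All.lookup (AllPairs⇒All-pairs (sort-descending S₀)) p∈) ⟩
        2 * a′ p + 1          ∎)
        where
        regroup : ∀ k p → 2 * (8 * k * p) ≡ 16 * k * p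
        regroup = solve-∀

      -- Every pair ranked no later than `p` is near at scale `suc j`. That scale is still below
      -- `suc J′`, so `sparse₀` bounds their number.
      room-near : ∀ {p} j → j < J′ → p ∈ pairs S → θ j < δ′ p → δ′ p ≤ θ (suc j) → length S + pairRank S p ≤ a′ p
      room-near {p} j j<J′ p∈ lo hi = begin
        length S + pairRank S p
          ≤⟨ +-mono-≤ (≤-reflexive |S|≡k)
               (∑-mono (pairs S) (λ q → 𝟙-mono (δ′ q ≤? δ′ p) (δ′ q ≤? θ (suc j)) (λ δ≤ → ≤-trans δ≤ hi))) ⟩
        k + crowd (suc j)                 ≤⟨ +-monoʳ-≤ k (≤-trans (≤-reflexive (crowd≡ (suc j))) (sparse₀ (s≤s j<J′))) ⟩
        k + 3 * k * (2 * 2 ^ j)           ≤⟨ +-monoˡ-≤ (3 * k * (2 * 2 ^ j)) (m≤m*n k (2 ^ j) {{m^n≢0 2 j}}) ⟩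
        k * 2 ^ j + 3 * k * (2 * 2 ^ j)   ≤⟨ m≤m+n _ (k * 2 ^ j) ⟩
        k * 2 ^ j + 3 * k * (2 * 2 ^ j) + k * 2 ^ j ≡⟨ regroup k (2 ^ j) ⟩
        8 * k * 2 ^ j                     ≤⟨ a-large p∈ j lo ⟩
        a′ p                              ∎
        where
        regroup : ∀ k p → k * p + 3 * k * (2 * p) + k * p ≡ 8 * k * p
        regroup = solve-∀

      -- Beyond the last scale the trivial bound `k * k` on the number of pairs is enough, because
      -- `k ≤ 2 * 2 ^ J′`.
      room-far : ∀ {p} → p ∈ pairs S → θ J′ < δ′ p → length S + pairRank S p ≤ a′ p
      room-far {p} p∈ θJ′<δ = begin
        length S + pairRank S p           ≤⟨ +-monoʳ-≤ (length S) (∑-mono (pairs S) (λ q → 𝟙≤1 (δ′ q ≤? δ′ p))) ⟩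
        length S + ∑[ q ∈ pairs S ] 1     ≡⟨ cong (length S +_) (≡.trans (∑-const (pairs S) 1) (*-identityʳ _)) ⟩
        length S + length (pairs S)       ≤⟨ +-monoʳ-≤ (length S) (length-pairs≤ S) ⟩
        length S + length S * length S    ≡⟨ cong (λ m → m + m * m) |S|≡k ⟩
        k + k * k                         ≤⟨ +-monoˡ-≤ (k * k) (m≤m*n k k {{>-nonZero (<⇒≤ 1<k)}}) ⟩
        k * k + k * k                     ≤⟨ m≤m+n _ (2 * (k * k)) ⟩
        k * k + k * k + 2 * (k * k)       ≡⟨ regroup₁ k ⟩
        4 * k * k                         ≤⟨ *-monoʳ-≤ (4 * k) k≤2^J ⟩
        4 * k * (2 * 2 ^ J′)              ≡⟨ regroup₂ k (2 ^ J′) ⟩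
        8 * k * 2 ^ J′                    ≤⟨ a-large p∈ J′ θJ′<δ ⟩
        a′ p                              ∎
        where
        regroup₁ : ∀ k → k * k + k * k + 2 * (k * k) ≡ 4 * k * k
        regroup₁ = solve-∀
        regroup₂ : ∀ k p → 4 * k * (2 * p) ≡ 8 * k * p
        regroup₂ = solve-∀

      room : ∀ {p} → p ∈ pairs S → length S + pairRank S p ≤ a′ p
      room {p} p∈ =
        [ (λ (j , j<J′ , lo , hi) → room-near j j<J′ p∈ lo hi) , room-far p∈ ]′ (locate θ (δ′ p) J′ (θ0<δ p∈))

      sparse-embedding : ContainsCopy T (H k)
      sparse-embedding = subst (λ m → ContainsCopy T (H m)) |S|≡k (embed S δ>0 room)

    contains-copy : ContainsCopy T (H k)
    contains-copy = at-scale (dyadic-scale k)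
      where
      at-scale : ∃[ J ] (k ≤ 2 ^ J × (∀ j → j < J → 2 ^ j ≤ k)) → ContainsCopy T (H k)
      at-scale (zero   , k≤1   , _)    = contradiction k≤1 (<⇒≱ 1<k)
      at-scale (suc J′ , k≤2^J , 2^≤k) =
        let S , |S|≡k , isolated , sparse =
              Selection.sparse-set V near (λ j p → 𝟙≤1 (δ′ p ≤? θ j)) k (suc J′) (192 * k)
                (<⇒≤ 1<k) (*-mono-≤ {1} {192} (s≤s z≤n) (<⇒≤ 1<k)) 2^≤k near-volume |V|-large
        in sparse-embedding J′ S k≤2^J |S|≡k isolated sparse

theorem1p1 : Σ[ C ∈ ℕ ] Σ[ k₀ ∈ ℕ ] (NonZero C × (∀ k → k₀ ≤ k → ∀ n → C * (k ^ 2) * loglog k ≤ n → (T : Tournament n) → ContainsCopy T (H k)))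
theorem1p1 = 384 , 3 , _ , λ k 3≤k n large T → Embedding.contains-copy T k (<⇒≤ 3≤k) (begin
    384 * (k * k)              ≡⟨ cong (λ m → 384 * (k * m)) (*-identityʳ k) ⟨
    384 * k ^ 2                ≡⟨ *-identityʳ _ ⟨
    -- `loglog 3` evaluates to 1, so by monotonicity `loglog k` is at least 1 from `k₀ = 3` on.
    384 * k ^ 2 * 1            ≤⟨ *-monoʳ-≤ (384 * k ^ 2) (⌈log₂⌉-mono-≤ (⌈log₂⌉-mono-≤ 3≤k)) ⟩
    384 * k ^ 2 * loglog k     ≤⟨ large ⟩
    n                          ∎)
  where open ≤-Reasoning
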